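{- Let QS4 be the modal predicate calculus obtained from classical predicate calculus by adding a unary connective $\Box$ with axiom schemes $\Box p\to p$, $\Box p\to\Box\Box p$, $\Box(p\to q)\to(\Box p\to\Box q)$ and the rule $p\,/\,\Box p$. Define a translation $A\mapsto A_\Box$ from formulas of QHC to formulas of QS4 by recursion: atomic propositions are unchanged, and $0_\Box=0$; $\bot_\Box=0$; each atomic problem $\pi(t_1,\dots,t_n)\neq\bot$ is sent to $\Box\bar\pi(t_1,\dots,t_n)$, where $\bar\pi$ is a proposition variable of the same arity assigned injectively to $\pi$ (and distinct from the proposition variables of QHC); classical connectives and quantifiers are kept; intuitionistic $\land,\lor,\exists$ become the classical ones ($(\alpha\land\beta)_\Box=\alpha_\Box\land\beta_\Box$, etc.); intuitionistic $\to$ and $\forall$ become classical and prefixed by $\Box$: $(\alpha\to\beta)_\Box=\Box(\alpha_\Box\to\beta_\Box)$, $(\forall x\,\alpha)_\Box=\Box\forall x\,\alpha_\Box$; $(?\alpha)_\Box=\alpha_\Box$; $(!p)_\Box=\Box p_\Box$. Then if $A_1,\dots,A_n\vdash_{\mathrm{QHC}} A$, we have $(A_1)_\Box,\dots,(A_n)_\Box\vdash_{\mathrm{QS4}} A_\Box$.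
   Context: QHC is a two-sorted first-order calculus. Its only terms are individual variables. Every formula is either a problem (denoted by Greek letters $\alpha,\beta,\gamma,\dots$) or a proposition (denoted by Latin letters $p,q,\dots$). Atomic formulas are proposition variables $p(t_1,\dots,t_n)$ (of proposition type), problem variables $\pi(t_1,\dots,t_n)$ (of problem type), and the constants $0$ (a proposition, classical falsity) and $\bot$ (a problem, intuitionistic absurdity). Propositions are closed under the classical connectives $\land,\lor,\to$ and quantifiers $\exists,\forall$; problems are closed under the intuitionistic connectives $\land,\lor,\to$ and quantifiers $\exists,\forall$ (the same symbols are used, distinguished by the type of the arguments). $\neg p$ abbreviates $p\to 0$, $\neg\alpha$ abbreviates $\alpha\to\bot$, and $\leftrightarrow$ is defined as usual. There are two type-conversion operators: if $p$ is a proposition then $!p$ is a problem, and if $\alpha$ is a problem then $?\alpha$ is a proposition. Deductive system of QHC: all axioms and rules of classical predicate logic applied to all propositions; all postulates and rules of intuitionistic predicate logic applied to all problems; the rules $p\,/\,!p$ and $\alpha\,/\,?\alpha$; and the schemas $?!p\to p$; $\alpha\to\, !?\alpha$; $!(p\to q)\to(!p\to !q)$; $?(\alpha\to\beta)\to(?\alpha\to ?\beta)$; $!0\to\bot$; $?(\alpha\land\beta)\leftrightarrow ?\alpha\land ?\beta$; $?(\alpha\lor\beta)\leftrightarrow ?\alpha\lor ?\beta$; $?\bot\to 0$; $?\exists x\,\alpha(x)\leftrightarrow\exists x\,?\alpha(x)$; $?\forall x\,\alpha(x)\to\forall x\,?\alpha(x)$ (usual variable side conditions implicit). $\vdash A$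 means $A$ is derivable in QHC; $A\Rightarrow B$ means $\vdash A\to B$ and $A\Leftrightarrow B$ means $\vdash A\leftrightarrow B$ (with $A,B$ of the same type); $A\vdash B$ means $B$ is derivable in QHC from the premise $A$. Notation: $\Box p := ?!p$ (a proposition) and $\nabla\alpha := !?\alpha$ (a problem). QC and QH denote classical and intuitionistic predicate calculus. -}

module Defs where

open import Data.Bool.Base using (if_then_else_)
open import Data.Empty using (⊥)
open import Data.List.Base as List using (List)
open import Data.List.Membership.Propositional using (_∈_)
open import Data.Nat.Base using (ℕ)
open import Data.Nat.Properties using (_≟_)
open import Data.Product.Base using (_×_; _,_; ∃; proj₂)
open import Data.Sum.Base using (_⊎_)
open import Data.Unit.Base using (⊤)
open import Data.Vec.Base as Vec using (Vec)
import Data.Vec.Membership.Propositional as VecMem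
open import Relation.Binary.PropositionalEquality.Core using (_≡_; _≢_)
open import Relation.Nullary.Decidable.Core using (does)
open import Relation.Nullary.Negation.Core using (¬_)

-- Formulas carry named individual variables, which are also the only terms.
Var : Set
Var = ℕ

-- The predicate variables of each arity.
Symbols : Set₁
Symbols = ℕ → Set

replace : Var → Var → Var → Var
replace x t y = if does (y ≟ x) then t else y

private
  variable
    n : ℕ
    x t : Var

module QHC where

  data Sort : Set where
    proposition problem : Sort

  infixr 8 _∧_
  infixr 7 _∨_
  infixr 6 _⊃_
  infix  5 _↔_
  infix  9 !_ ¿_ ~_ ∀[_]_ ∃[_]_

  -- P and Π are the proposition variables and the problem variables.
  -- 𝟘 is 0 at sort proposition and ⊥ at sort problem; ¿ is the operator "?",
  -- whose usual symbol is reserved in Agda.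
  data Formula (P Π : Symbols) : Sort → Set where
    propVar      : P n → Vec Var n → Formula P Π proposition
    probVar      : Π n → Vec Var n → Formula P Π problem
    𝟘            : ∀ {s} → Formula P Π s
    _∧_ _∨_ _⊃_  : ∀ {s} → Formula P Π s → Formula P Π s → Formula P Π s
    ∀[_]_ ∃[_]_  : ∀ {s} → Var → Formula P Π s → Formula P Π s
    !_           : Formula P Π proposition → Formula P Π problem
    ¿_           : Formula P Π problem → Formula P Π proposition

  private
    variable
      P Π : Symbols
      s : Sort

  ~_ : Formula P Π s → Formula P Π s
  ~ A = A ⊃ 𝟘

  _↔_ : Formula P Π s → Formula P Π s → Formula P Π s
  A ↔ B = (A ⊃ B) ∧ (B ⊃ A)

  Free : Var → Formula P Π s → Set
  Free x (propVar p ts) = x VecMem.∈ ts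
  Free x (probVar π ts) = x VecMem.∈ ts
  Free x 𝟘              = ⊥
  Free x (A ∧ B)        = Free x A ⊎ Free x B
  Free x (A ∨ B)        = Free x A ⊎ Free x B
  Free x (A ⊃ B)        = Free x A ⊎ Free x B
  Free x (∀[ y ] A)     = x ≢ y × Free x A
  Free x (∃[ y ] A)     = x ≢ y × Free x A
  Free x (! A)          = Free x A
  Free x (¿ A)          = Free x A

  -- A [ t / x ] replaces the free occurrences of x by t without renaming bound
  -- variables; it is only meaningful together with FreeFor t x A.
  _[_/_] : Formula P Π s → Var → Var → Formula P Π s
  propVar p ts [ t / x ] = propVar p (Vec.map (replace x t) ts)
  probVar π ts [ t / x ] = probVar π (Vec.map (replace x t) ts)
  𝟘            [ t / x ] = 𝟘
  (A ∧ B)      [ t / x ] = A [ t / x ] ∧ B [ t / x ]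
  (A ∨ B)      [ t / x ] = A [ t / x ] ∨ B [ t / x ]
  (A ⊃ B)      [ t / x ] = A [ t / x ] ⊃ B [ t / x ]
  (∀[ y ] A)   [ t / x ] = ∀[ y ] (if does (y ≟ x) then A else A [ t / x ])
  (∃[ y ] A)   [ t / x ] = ∃[ y ] (if does (y ≟ x) then A else A [ t / x ])
  (! A)        [ t / x ] = ! (A [ t / x ])
  (¿ A)        [ t / x ] = ¿ (A [ t / x ])

  -- No free occurrence of x lies in the scope of a quantifier binding t.
  FreeFor : Var → Var → Formula P Π s → Set
  FreeFor t x (propVar p ts) = ⊤
  FreeFor t x (probVar π ts) = ⊤
  FreeFor t x 𝟘              = ⊤
  FreeFor t x (A ∧ B)        = FreeFor t x A × FreeFor t x B
  FreeFor t x (A ∨ B)        = FreeFor t x A × FreeFor t x B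
  FreeFor t x (A ⊃ B)        = FreeFor t x A × FreeFor t x B
  FreeFor t x (∀[ y ] A)     = ¬ Free x (∀[ y ] A) ⊎ (t ≢ y × FreeFor t x A)
  FreeFor t x (∃[ y ] A)     = ¬ Free x (∃[ y ] A) ⊎ (t ≢ y × FreeFor t x A)
  FreeFor t x (! A)          = FreeFor t x A
  FreeFor t x (¿ A)          = FreeFor t x A

  infix 3 _⊢_

  -- Derivability from premises, which may be of both sorts. All rules,
  -- generalization included, apply to arbitrary formulas derived from Γ.
  -- Schemas stated for both sorts axiomatize intuitionistic predicate logic;
  -- excluded middle makes the logic of propositions classical.
  data _⊢_ {P Π : Symbols} (Γ : List (∃ (Formula P Π))) : ∀ {s} → Formula P Π s → Set where
    premise : ∀ {s} {A : Formula P Π s} → (s , A) ∈ Γ → Γ ⊢ A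

    mp  : ∀ {s} {A B : Formula P Π s} → Γ ⊢ A ⊃ B → Γ ⊢ A → Γ ⊢ B
    gen : ∀ {s} {A : Formula P Π s} → Γ ⊢ A → Γ ⊢ ∀[ x ] A

    ax-K   : ∀ {s} {A B : Formula P Π s} → Γ ⊢ A ⊃ (B ⊃ A)
    ax-S   : ∀ {s} {A B C : Formula P Π s} → Γ ⊢ (A ⊃ (B ⊃ C)) ⊃ ((A ⊃ B) ⊃ (A ⊃ C))
    ax-∧₁  : ∀ {s} {A B : Formula P Π s} → Γ ⊢ (A ∧ B) ⊃ A
    ax-∧₂  : ∀ {s} {A B : Formula P Π s} → Γ ⊢ (A ∧ B) ⊃ B
    ax-∧ⁱ  : ∀ {s} {A B : Formula P Π s} → Γ ⊢ A ⊃ (B ⊃ (A ∧ B))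
    ax-∨₁  : ∀ {s} {A B : Formula P Π s} → Γ ⊢ A ⊃ (A ∨ B)
    ax-∨₂  : ∀ {s} {A B : Formula P Π s} → Γ ⊢ B ⊃ (A ∨ B)
    ax-∨ᵉ  : ∀ {s} {A B C : Formula P Π s} → Γ ⊢ (A ⊃ C) ⊃ ((B ⊃ C) ⊃ ((A ∨ B) ⊃ C))
    ax-efq : ∀ {s} {A : Formula P Π s} → Γ ⊢ 𝟘 ⊃ A
    ax-∀ᵉ  : ∀ {s} {A : Formula P Π s} → FreeFor t x A → Γ ⊢ (∀[ x ] A) ⊃ (A [ t / x ])
    ax-∃ⁱ  : ∀ {s} {A : Formula P Π s} → FreeFor t x A → Γ ⊢ (A [ t / x ]) ⊃ (∃[ x ] A)
    ax-∀ⁱ  : ∀ {s} {A B : Formula P Π s} → ¬ Free x B → Γ ⊢ (∀[ x ] (B ⊃ A)) ⊃ (B ⊃ ∀[ x ] A)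
    ax-∃ᵉ  : ∀ {s} {A B : Formula P Π s} → ¬ Free x B → Γ ⊢ (∀[ x ] (A ⊃ B)) ⊃ ((∃[ x ] A) ⊃ B)

    ax-lem : {p : Formula P Π proposition} → Γ ⊢ p ∨ ~ p

    !-rule : {p : Formula P Π proposition} → Γ ⊢ p → Γ ⊢ ! p
    ¿-rule : {α : Formula P Π problem} → Γ ⊢ α → Γ ⊢ ¿ α

    ax-¿!  : {p : Formula P Π proposition} → Γ ⊢ (¿ (! p)) ⊃ p
    ax-!¿  : {α : Formula P Π problem} → Γ ⊢ α ⊃ (! (¿ α))
    ax-!⊃  : {p q : Formula P Π proposition} → Γ ⊢ (! (p ⊃ q)) ⊃ ((! p) ⊃ (! q))
    ax-¿⊃  : {α β : Formula P Π problem} → Γ ⊢ (¿ (α ⊃ β)) ⊃ ((¿ α) ⊃ (¿ β))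
    ax-!𝟘  : Γ ⊢ (! 𝟘) ⊃ 𝟘
    ax-¿∧  : {α β : Formula P Π problem} → Γ ⊢ (¿ (α ∧ β)) ↔ ((¿ α) ∧ (¿ β))
    ax-¿∨  : {α β : Formula P Π problem} → Γ ⊢ (¿ (α ∨ β)) ↔ ((¿ α) ∨ (¿ β))
    ax-¿𝟘  : Γ ⊢ (¿ 𝟘) ⊃ 𝟘
    ax-¿∃  : {α : Formula P Π problem} → Γ ⊢ (¿ (∃[ x ] α)) ↔ (∃[ x ] (¿ α))
    ax-¿∀  : {α : Formula P Π problem} → Γ ⊢ (¿ (∀[ x ] α)) ⊃ (∀[ x ] (¿ α))

module QS4 where

  infixr 8 _∧_
  infixr 7 _∨_
  infixr 6 _⊃_
  infix  9 □_ ~_ ∀[_]_ ∃[_]_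

  data Formula (V : Symbols) : Set where
    var          : V n → Vec Var n → Formula V
    𝟘            : Formula V
    _∧_ _∨_ _⊃_  : Formula V → Formula V → Formula V
    ∀[_]_ ∃[_]_  : Var → Formula V → Formula V
    □_           : Formula V → Formula V

  private
    variable
      V : Symbols

  ~_ : Formula V → Formula V
  ~ A = A ⊃ 𝟘

  Free : Var → Formula V → Set
  Free x (var p ts)  = x VecMem.∈ ts
  Free x 𝟘           = ⊥
  Free x (A ∧ B)     = Free x A ⊎ Free x B
  Free x (A ∨ B)     = Free x A ⊎ Free x B
  Free x (A ⊃ B)     = Free x A ⊎ Free x B
  Free x (∀[ y ] A)  = x ≢ y × Free x A
  Free x (∃[ y ] A)  = x ≢ y × Free x A
  Free x (□ A)       = Free x A

  _[_/_] : Formula V → Var → Var → Formula V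
  var p ts   [ t / x ] = var p (Vec.map (replace x t) ts)
  𝟘          [ t / x ] = 𝟘
  (A ∧ B)    [ t / x ] = A [ t / x ] ∧ B [ t / x ]
  (A ∨ B)    [ t / x ] = A [ t / x ] ∨ B [ t / x ]
  (A ⊃ B)    [ t / x ] = A [ t / x ] ⊃ B [ t / x ]
  (∀[ y ] A) [ t / x ] = ∀[ y ] (if does (y ≟ x) then A else A [ t / x ])
  (∃[ y ] A) [ t / x ] = ∃[ y ] (if does (y ≟ x) then A else A [ t / x ])
  (□ A)      [ t / x ] = □ (A [ t / x ])

  FreeFor : Var → Var → Formula V → Set
  FreeFor t x (var p ts)  = ⊤
  FreeFor t x 𝟘           = ⊤
  FreeFor t x (A ∧ B)     = FreeFor t x A × FreeFor t x B
  FreeFor t x (A ∨ B)     = FreeFor t x A × FreeFor t x B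
  FreeFor t x (A ⊃ B)     = FreeFor t x A × FreeFor t x B
  FreeFor t x (∀[ y ] A)  = ¬ Free x (∀[ y ] A) ⊎ (t ≢ y × FreeFor t x A)
  FreeFor t x (∃[ y ] A)  = ¬ Free x (∃[ y ] A) ⊎ (t ≢ y × FreeFor t x A)
  FreeFor t x (□ A)       = FreeFor t x A

  infix 3 _⊢_

  data _⊢_ {V : Symbols} (Γ : List (Formula V)) : Formula V → Set where
    premise : {A : Formula V} → A ∈ Γ → Γ ⊢ A

    mp  : {A B : Formula V} → Γ ⊢ A ⊃ B → Γ ⊢ A → Γ ⊢ B
    gen : {A : Formula V} → Γ ⊢ A → Γ ⊢ ∀[ x ] A

    ax-K   : {A B : Formula V} → Γ ⊢ A ⊃ (B ⊃ A)
    ax-S   : {A B C : Formula V} → Γ ⊢ (A ⊃ (B ⊃ C)) ⊃ ((A ⊃ B) ⊃ (A ⊃ C))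
    ax-∧₁  : {A B : Formula V} → Γ ⊢ (A ∧ B) ⊃ A
    ax-∧₂  : {A B : Formula V} → Γ ⊢ (A ∧ B) ⊃ B
    ax-∧ⁱ  : {A B : Formula V} → Γ ⊢ A ⊃ (B ⊃ (A ∧ B))
    ax-∨₁  : {A B : Formula V} → Γ ⊢ A ⊃ (A ∨ B)
    ax-∨₂  : {A B : Formula V} → Γ ⊢ B ⊃ (A ∨ B)
    ax-∨ᵉ  : {A B C : Formula V} → Γ ⊢ (A ⊃ C) ⊃ ((B ⊃ C) ⊃ ((A ∨ B) ⊃ C))
    ax-efq : {A : Formula V} → Γ ⊢ 𝟘 ⊃ A
    ax-lem : {A : Formula V} → Γ ⊢ A ∨ ~ A
    ax-∀ᵉ  : {A : Formula V} → FreeFor t x A → Γ ⊢ (∀[ x ] A) ⊃ (A [ t / x ])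
    ax-∃ⁱ  : {A : Formula V} → FreeFor t x A → Γ ⊢ (A [ t / x ]) ⊃ (∃[ x ] A)
    ax-∀ⁱ  : {A B : Formula V} → ¬ Free x B → Γ ⊢ (∀[ x ] (B ⊃ A)) ⊃ (B ⊃ ∀[ x ] A)
    ax-∃ᵉ  : {A B : Formula V} → ¬ Free x B → Γ ⊢ (∀[ x ] (A ⊃ B)) ⊃ ((∃[ x ] A) ⊃ B)

    nec  : {A : Formula V} → Γ ⊢ A → Γ ⊢ □ A
    ax-T : {A : Formula V} → Γ ⊢ (□ A) ⊃ A
    ax-4 : {A : Formula V} → Γ ⊢ (□ A) ⊃ (□ (□ A))
    ax-□ : {A B : Formula V} → Γ ⊢ (□ (A ⊃ B)) ⊃ ((□ A) ⊃ (□ B))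

-- The proposition variables V of QS4 contain those of QHC (via keep) and,
-- apart from them, a variable bar π for each problem variable π.
record Assignment (P Π V : Symbols) : Set where
  field
    keep           : P n → V n
    bar            : Π n → V n
    keep-injective : {p q : P n} → keep p ≡ keep q → p ≡ q
    bar-injective  : {π ρ : Π n} → bar π ≡ bar ρ → π ≡ ρ
    keep≢bar       : {p : P n} {π : Π n} → keep p ≢ bar π

module Translation {P Π V : Symbols} (E : Assignment P Π V) where
  open Assignment E
  open QHC using (proposition; problem; propVar; probVar; 𝟘; _∧_; _∨_; _⊃_; ∀[_]_; ∃[_]_; !_; ¿_)
  open QS4 using (var; 𝟘; _∧_; _∨_; _⊃_; ∀[_]_; ∃[_]_; □_)

  ⟦_⟧ : ∀ {s} → QHC.Formula P Π s → QS4.Formula V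
  ⟦ propVar p ts ⟧                = var (keep p) ts
  ⟦ probVar π ts ⟧                = □ (var (bar π) ts)
  ⟦ 𝟘 ⟧                           = 𝟘
  ⟦ A ∧ B ⟧                       = ⟦ A ⟧ ∧ ⟦ B ⟧
  ⟦ A ∨ B ⟧                       = ⟦ A ⟧ ∨ ⟦ B ⟧
  ⟦_⟧ {proposition} (A ⊃ B)       = ⟦ A ⟧ ⊃ ⟦ B ⟧
  ⟦_⟧ {problem}     (A ⊃ B)       = □ (⟦ A ⟧ ⊃ ⟦ B ⟧)
  ⟦_⟧ {proposition} (∀[ x ] A)    = ∀[ x ] ⟦ A ⟧
  ⟦_⟧ {problem}     (∀[ x ] A)    = □ (∀[ x ] ⟦ A ⟧)
  ⟦ ∃[ x ] A ⟧                    = ∃[ x ] ⟦ A ⟧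
  ⟦ ! A ⟧                         = □ ⟦ A ⟧
  ⟦ ¿ A ⟧                         = ⟦ A ⟧

  ⟦_⟧* : List (∃ (QHC.Formula P Π)) → List (QS4.Formula V)
  ⟦_⟧* = List.map (λ A → ⟦ proj₂ A ⟧)

{-# OPTIONS --safe #-}
-- The translation of every problem α is stable: ⊢ α_□ → □ α_□. Hence, under
-- hypotheses that are translations of problems, necessitation is admissible,
-- so the boxed implications and universal quantifiers obey the intuitionistic
-- laws. The remaining axioms of QHC become instances of those of S4.
module Submission where

open import Defs
open import Data.Bool.Base using (if_then_else_)
open import Data.Bool.Properties using (if-float; if-eta)
open import Data.List.Base using (List; []; _∷_)
open import Data.List.Membership.Propositional using (_∈_)
open import Data.List.Membership.Propositional.Properties using (∈-map⁺)
open import Data.List.Relation.Unary.All using (All; []; _∷_)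
open import Data.List.Relation.Unary.Any using (here; there)
open import Data.Nat.Properties using (_≟_)
open import Data.Product.Base as Product using (∃; _,_; proj₂)
open import Data.Sum.Base as Sum using (inj₁; inj₂)
open import Data.Unit.Base using (tt)
import Data.Vec.Properties as Vec
open import Function.Base using (_∘_; id)
open import Relation.Binary.PropositionalEquality using (_≡_; refl; sym; trans; cong; cong₂; subst)
open import Relation.Nullary.Decidable.Core using (Dec; does; yes; no)

open QS4 hiding (Formula; Free; _[_/_]; FreeFor; _⊢_; ~_)
open QHC hiding (Formula; Free; _[_/_]; FreeFor; _⊢_; ~_; _↔_)

-- Stated for an arbitrary decision because does (y ≟ x) reduces to a Boolean
-- test, which a case distinction on y ≟ x does not abstract.
if-≡-else : {x y : Var} (y≟x : Dec (y ≡ x)) → (if does y≟x then x else y) ≡ y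
if-≡-else (yes refl) = refl
if-≡-else (no  _)    = refl

-- Replacing a variable by itself.

module _ {V : Symbols} where

  -- Instantiating the quantifier axioms at the bound variable itself then yields `∀-elim` and
  -- `∃-intro`.
  []-self : ∀ x (A : QS4.Formula V) → A QS4.[ x / x ] ≡ A
  []-self x (var p ts)   = cong (var p) (trans (Vec.map-cong (λ y → if-≡-else (y ≟ x)) ts) (Vec.map-id ts))
  []-self x 𝟘            = refl
  []-self x (A ∧ B)      = cong₂ _∧_ ([]-self x A) ([]-self x B)
  []-self x (A ∨ B)      = cong₂ _∨_ ([]-self x A) ([]-self x B)
  []-self x (A ⊃ B)      = cong₂ _⊃_ ([]-self x A) ([]-self x B)
  []-self x (∀[ y ] A)   =
    -- By induction both branches of the test become `A`, so `if-eta` removes it without deciding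
    -- `y ≟ x`.
    cong (∀[ y ]_) (trans (cong (if does (y ≟ x) then A else_) ([]-self x A)) (if-eta (does (y ≟ x))))
  []-self x (∃[ y ] A)   =
    cong (∃[ y ]_) (trans (cong (if does (y ≟ x) then A else_) ([]-self x A)) (if-eta (does (y ≟ x))))
  []-self x (□ A)        = cong □_ ([]-self x A)

  FreeFor-self : ∀ x (A : QS4.Formula V) → QS4.FreeFor x x A
  FreeFor-self x (var p ts) = tt
  FreeFor-self x 𝟘          = tt
  FreeFor-self x (A ∧ B)    = FreeFor-self x A , FreeFor-self x B
  FreeFor-self x (A ∨ B)    = FreeFor-self x A , FreeFor-self x B
  FreeFor-self x (A ⊃ B)    = FreeFor-self x A , FreeFor-self x B
  FreeFor-self x (∀[ y ] A) with x ≟ y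
  ... | yes x≡y = inj₁ λ (x≢y , _) → x≢y x≡y
  ... | no  x≢y = inj₂ (x≢y , FreeFor-self x A)
  FreeFor-self x (∃[ y ] A) with x ≟ y
  ... | yes x≡y = inj₁ λ (x≢y , _) → x≢y x≡y
  ... | no  x≢y = inj₂ (x≢y , FreeFor-self x A)
  FreeFor-self x (□ A)      = FreeFor-self x A

-- Hypothetical reasoning in QS4.

module Deduction {V : Symbols} (Γ : List (QS4.Formula V)) where

  private
    variable
      A B C : QS4.Formula V
      Δ : List (QS4.Formula V)
      x : Var

  infix 3 ⊢_ _⊩_

  ⊢_ : QS4.Formula V → Set
  ⊢ A = Γ QS4.⊢ A

  Stable : QS4.Formula V → Set
  Stable A = ⊢ A ⊃ □ A

  infixr 4 _⇛_

  -- The head of the list becomes the innermost antecedent, so discharging it is a definitional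
  -- equality.
  _⇛_ : List (QS4.Formula V) → QS4.Formula V → QS4.Formula V
  []      ⇛ A = A
  (B ∷ Δ) ⇛ A = Δ ⇛ (B ⊃ A)

  infixl 6 _·_

  -- The premises Γ are global: generalization and necessitation apply to them.
  -- The hypotheses Δ are local, whence the side condition of box.
  data _⊩_ (Δ : List (QS4.Formula V)) : QS4.Formula V → Set where
    thm : ⊢ A → Δ ⊩ A
    hyp : A ∈ Δ → Δ ⊩ A
    _·_ : Δ ⊩ A ⊃ B → Δ ⊩ A → Δ ⊩ B
    ƛ   : A ∷ Δ ⊩ B → Δ ⊩ A ⊃ B
    box : All Stable Δ → Δ ⊩ A → Δ ⊩ □ A

  ⇛-thm : ∀ Δ → ⊢ A → ⊢ Δ ⇛ A
  ⇛-thm []      d = d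
  ⇛-thm (B ∷ Δ) d = ⇛-thm Δ (mp ax-K d)

  ⇛-mp : ∀ Δ → ⊢ Δ ⇛ A ⊃ B → ⊢ Δ ⇛ A → ⊢ Δ ⇛ B
  ⇛-mp []      d e = mp d e
  ⇛-mp (C ∷ Δ) d e = ⇛-mp Δ (⇛-mp Δ (⇛-thm Δ ax-S) d) e

  ⇛-hyp : A ∈ Δ → ⊢ Δ ⇛ A
  ⇛-hyp {A} {Δ = B ∷ Δ} (here refl) = ⇛-thm Δ (mp (mp ax-S ax-K) (ax-K {B = A}))
  ⇛-hyp {Δ = B ∷ Δ} (there i)       = ⇛-mp Δ (⇛-thm Δ ax-K) (⇛-hyp i)

  -- Boxing `B ⊃ A` and distributing gives `□ B ⊃ □ A`; stability of `B` then replaces `□ B` by `B`.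
  ⇛-box : All Stable Δ → ⊢ Δ ⇛ A → ⊢ Δ ⇛ □ A
  ⇛-box []                   d = nec d
  ⇛-box {Δ = B ∷ Δ} (st ∷ sts) d =
    -- The stability theorem `B ⊃ □ B` under `Δ` is read as `□ B` under `B ∷ Δ`.
    ⇛-mp (B ∷ Δ) (⇛-mp Δ (⇛-thm Δ ax-K) (⇛-mp Δ (⇛-thm Δ ax-□) (⇛-box sts d))) (⇛-thm Δ st)

  -- This is the deduction theorem. Generalization occurs only inside `thm`, away from the local
  -- hypotheses, so `ƛ` carries no variable condition.
  ⊩⇒⊢⇛ : ∀ Δ → Δ ⊩ A → ⊢ Δ ⇛ A
  ⊩⇒⊢⇛ Δ (thm d)     = ⇛-thm Δ d
  ⊩⇒⊢⇛ Δ (hyp i)     = ⇛-hyp i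
  ⊩⇒⊢⇛ Δ (d · e)     = ⇛-mp Δ (⊩⇒⊢⇛ Δ d) (⊩⇒⊢⇛ Δ e)
  ⊩⇒⊢⇛ Δ (ƛ d)       = ⊩⇒⊢⇛ (_ ∷ Δ) d
  ⊩⇒⊢⇛ Δ (box sts d) = ⇛-box sts (⊩⇒⊢⇛ Δ d)

  prove : [] ⊩ A → ⊢ A
  prove = ⊩⇒⊢⇛ []

  pattern h₀ = hyp (here refl)
  pattern h₁ = hyp (there (here refl))
  pattern h₂ = hyp (there (there (here refl)))

  ⊃-refl : ⊢ A ⊃ A
  ⊃-refl = prove (ƛ h₀)

  ƛ□ : All Stable Δ → A ∷ Δ ⊩ B → Δ ⊩ □ (A ⊃ B)
  ƛ□ sts d = box sts (ƛ d)

  unbox : Δ ⊩ □ A → Δ ⊩ A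
  unbox d = thm ax-T · d

  □-mono : ⊢ A ⊃ B → ⊢ □ A ⊃ □ B
  □-mono d = mp ax-□ (nec d)

  ∀-elim : ⊢ ∀[ x ] A ⊃ A
  ∀-elim {x} {A} = subst (λ B → ⊢ ∀[ x ] A ⊃ B) ([]-self x A) (ax-∀ᵉ (FreeFor-self x A))

  ∃-intro : ⊢ A ⊃ ∃[ x ] A
  ∃-intro {A} {x} = subst (λ B → ⊢ B ⊃ ∃[ x ] A) ([]-self x A) (ax-∃ⁱ (FreeFor-self x A))

  ∀-mono : ⊢ A ⊃ B → ⊢ ∀[ x ] A ⊃ ∀[ x ] B
  ∀-mono d = mp (ax-∀ⁱ λ (x≢x , _) → x≢x refl) (gen (prove (ƛ (thm d · (thm ∀-elim · h₀)))))

  □-stable : Stable (□ A)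
  □-stable = ax-4

  -- Necessitate the pairing axiom and distribute the box over its two implications.
  ∧-stable : Stable A → Stable B → Stable (A ∧ B)
  ∧-stable s t = prove (ƛ (thm ax-□ · (thm ax-□ · thm (nec ax-∧ⁱ) · (thm s · (thm ax-∧₁ · h₀)))
                                     · (thm t · (thm ax-∧₂ · h₀))))

  ∨-stable : Stable A → Stable B → Stable (A ∨ B)
  ∨-stable s t = prove (thm ax-∨ᵉ · ƛ (thm (□-mono ax-∨₁) · (thm s · h₀))
                                  · ƛ (thm (□-mono ax-∨₂) · (thm t · h₀)))

  -- As `x` is not free in `□ (∃[ x ] A)`, it suffices to reach that formula from `A`, through
  -- `□ A`.
  ∃-stable : Stable A → Stable (∃[ x ] A)
  ∃-stable s = mp (ax-∃ᵉ λ (x≢x , _) → x≢x refl)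
                  (gen (prove (ƛ (thm (□-mono ∃-intro) · (thm s · h₀)))))

-- The translation and the variable conditions.

module _ {P Π V : Symbols} (E : Assignment P Π V) where
  open Translation E

  -- This direction carries non-freeness from QHC to QS4. The sort is split at `⊃` and `∀` because
  -- `⟦_⟧` reduces there only once it is known.
  Free-⟦⟧ : ∀ {x s} (A : QHC.Formula P Π s) → QS4.Free x ⟦ A ⟧ → QHC.Free x A
  Free-⟦⟧ (propVar p ts) = id
  Free-⟦⟧ (probVar π ts) = id
  Free-⟦⟧ 𝟘              = id
  Free-⟦⟧ (A ∧ B)        = Sum.map (Free-⟦⟧ A) (Free-⟦⟧ B)
  Free-⟦⟧ (A ∨ B)        = Sum.map (Free-⟦⟧ A) (Free-⟦⟧ B)
  Free-⟦⟧ {s = proposition} (A ⊃ B)    = Sum.map (Free-⟦⟧ A) (Free-⟦⟧ B)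
  Free-⟦⟧ {s = problem}     (A ⊃ B)    = Sum.map (Free-⟦⟧ A) (Free-⟦⟧ B)
  Free-⟦⟧ {s = proposition} (∀[ y ] A) = Product.map₂ (Free-⟦⟧ A)
  Free-⟦⟧ {s = problem}     (∀[ y ] A) = Product.map₂ (Free-⟦⟧ A)
  Free-⟦⟧ (∃[ y ] A)     = Product.map₂ (Free-⟦⟧ A)
  Free-⟦⟧ (! A)          = Free-⟦⟧ A
  Free-⟦⟧ (¿ A)          = Free-⟦⟧ A

  FreeFor-⟦⟧ : ∀ {t x s} (A : QHC.Formula P Π s) → QHC.FreeFor t x A → QS4.FreeFor t x ⟦ A ⟧
  FreeFor-⟦⟧ (propVar p ts) = id
  FreeFor-⟦⟧ (probVar π ts) = id
  FreeFor-⟦⟧ 𝟘              = id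
  FreeFor-⟦⟧ (A ∧ B)        = Product.map (FreeFor-⟦⟧ A) (FreeFor-⟦⟧ B)
  FreeFor-⟦⟧ (A ∨ B)        = Product.map (FreeFor-⟦⟧ A) (FreeFor-⟦⟧ B)
  FreeFor-⟦⟧ {s = proposition} (A ⊃ B)    = Product.map (FreeFor-⟦⟧ A) (FreeFor-⟦⟧ B)
  FreeFor-⟦⟧ {s = problem}     (A ⊃ B)    = Product.map (FreeFor-⟦⟧ A) (FreeFor-⟦⟧ B)
  FreeFor-⟦⟧ {s = proposition} (∀[ y ] A) =
    -- The first disjunct is a negation, hence contravariant in freeness.
    Sum.map (_∘ Product.map₂ (Free-⟦⟧ A)) (Product.map₂ (FreeFor-⟦⟧ A))
  FreeFor-⟦⟧ {s = problem}     (∀[ y ] A) =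
    Sum.map (_∘ Product.map₂ (Free-⟦⟧ A)) (Product.map₂ (FreeFor-⟦⟧ A))
  FreeFor-⟦⟧ (∃[ y ] A)     =
    Sum.map (_∘ Product.map₂ (Free-⟦⟧ A)) (Product.map₂ (FreeFor-⟦⟧ A))
  FreeFor-⟦⟧ (! A)          = FreeFor-⟦⟧ A
  FreeFor-⟦⟧ (¿ A)          = FreeFor-⟦⟧ A

  mutual
    ⟦⟧-[] : ∀ t x {s} (A : QHC.Formula P Π s) → ⟦ A QHC.[ t / x ] ⟧ ≡ ⟦ A ⟧ QS4.[ t / x ]
    ⟦⟧-[] t x (propVar p ts) = refl
    ⟦⟧-[] t x (probVar π ts) = refl
    ⟦⟧-[] t x 𝟘              = refl
    ⟦⟧-[] t x (A ∧ B)        = cong₂ _∧_ (⟦⟧-[] t x A) (⟦⟧-[] t x B)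
    ⟦⟧-[] t x (A ∨ B)        = cong₂ _∨_ (⟦⟧-[] t x A) (⟦⟧-[] t x B)
    ⟦⟧-[] t x {proposition} (A ⊃ B)    = cong₂ _⊃_ (⟦⟧-[] t x A) (⟦⟧-[] t x B)
    ⟦⟧-[] t x {problem}     (A ⊃ B)    = cong □_ (cong₂ _⊃_ (⟦⟧-[] t x A) (⟦⟧-[] t x B))
    ⟦⟧-[] t x {proposition} (∀[ y ] A) = cong (∀[ y ]_) (⟦⟧-[]-under t x y A)
    ⟦⟧-[] t x {problem}     (∀[ y ] A) = cong (λ B → □ (∀[ y ] B)) (⟦⟧-[]-under t x y A)
    ⟦⟧-[] t x (∃[ y ] A)     = cong (∃[ y ]_) (⟦⟧-[]-under t x y A)
    ⟦⟧-[] t x (! A)          = cong □_ (⟦⟧-[] t x A)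
    ⟦⟧-[] t x (¿ A)          = ⟦⟧-[] t x A

    -- Floating `⟦_⟧` through the Boolean test treats shadowed and unshadowed `x` together.
    ⟦⟧-[]-under : ∀ t x y {s} (A : QHC.Formula P Π s) →
                  ⟦ if does (y ≟ x) then A else A QHC.[ t / x ] ⟧ ≡
                  (if does (y ≟ x) then ⟦ A ⟧ else ⟦ A ⟧ QS4.[ t / x ])
    ⟦⟧-[]-under t x y A =
      trans (if-float ⟦_⟧ (does (y ≟ x))) (cong (if does (y ≟ x) then ⟦ A ⟧ else_) (⟦⟧-[] t x A))

  -- Soundness of the translation.

  module _ (Γ : List (∃ (QHC.Formula P Π))) where
    open Deduction ⟦ Γ ⟧*

    -- A translated problem either starts with a box, where `ax-4` applies, or is built from `𝟘` and
    -- stable parts by `∧`, `∨`, `∃`.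
    problem-stable : (α : QHC.Formula P Π problem) → Stable ⟦ α ⟧
    problem-stable (probVar π ts) = □-stable
    problem-stable 𝟘              = ax-efq
    problem-stable (α ∧ β)        = ∧-stable (problem-stable α) (problem-stable β)
    problem-stable (α ∨ β)        = ∨-stable (problem-stable α) (problem-stable β)
    problem-stable (α ⊃ β)        = □-stable
    problem-stable (∀[ x ] α)     = □-stable
    problem-stable (∃[ x ] α)     = ∃-stable (problem-stable α)
    problem-stable (! p)          = □-stable

    ∀ᵉ-⟦⟧ : ∀ {t x s} (A : QHC.Formula P Π s) → QHC.FreeFor t x A →
            ⊢ ∀[ x ] ⟦ A ⟧ ⊃ ⟦ A QHC.[ t / x ] ⟧
    ∀ᵉ-⟦⟧ {t} {x} A ff =
      subst (λ B → ⊢ ∀[ x ] ⟦ A ⟧ ⊃ B) (sym (⟦⟧-[] t x A)) (ax-∀ᵉ (FreeFor-⟦⟧ A ff))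

    ∃ⁱ-⟦⟧ : ∀ {t x s} (A : QHC.Formula P Π s) → QHC.FreeFor t x A →
            ⊢ ⟦ A QHC.[ t / x ] ⟧ ⊃ ∃[ x ] ⟦ A ⟧
    ∃ⁱ-⟦⟧ {t} {x} A ff =
      subst (λ B → ⊢ B ⊃ ∃[ x ] ⟦ A ⟧) (sym (⟦⟧-[] t x A)) (ax-∃ⁱ (FreeFor-⟦⟧ A ff))

    ⟦⟧-sound : ∀ {s} {A : QHC.Formula P Π s} → Γ QHC.⊢ A → ⊢ ⟦ A ⟧
    ⟦⟧-sound (premise i) = premise (∈-map⁺ (λ A → ⟦ proj₂ A ⟧) i)
    ⟦⟧-sound {proposition} (mp d e) = mp (⟦⟧-sound d) (⟦⟧-sound e)
    ⟦⟧-sound {problem}     (mp d e) = mp (mp ax-T (⟦⟧-sound d)) (⟦⟧-sound e)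
    ⟦⟧-sound {proposition} (gen d)  = gen (⟦⟧-sound d)
    -- Necessitation is sound here because the premises are global.
    ⟦⟧-sound {problem}     (gen d)  = nec (gen (⟦⟧-sound d))
    ⟦⟧-sound {proposition} ax-K = ax-K
    ⟦⟧-sound {problem} (ax-K {A = α}) =
      -- The inner box is introduced under the hypothesis `⟦ α ⟧`, so stability of problems enters.
      prove (ƛ□ [] (ƛ□ (problem-stable α ∷ []) h₁))
    ⟦⟧-sound {proposition} ax-S = ax-S
    ⟦⟧-sound {problem} ax-S =
      prove (ƛ□ [] (ƛ□ (□-stable ∷ []) (ƛ□ (□-stable ∷ □-stable ∷ [])
        -- The outer `unbox` opens the nested implication from the second to the third formula.
        (unbox (unbox h₂ · h₀) · (unbox h₁ · h₀)))))
    ⟦⟧-sound {proposition} ax-∧₁ = ax-∧₁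
    ⟦⟧-sound {problem}     ax-∧₁ = nec ax-∧₁
    ⟦⟧-sound {proposition} ax-∧₂ = ax-∧₂
    ⟦⟧-sound {problem}     ax-∧₂ = nec ax-∧₂
    ⟦⟧-sound {proposition} ax-∧ⁱ = ax-∧ⁱ
    ⟦⟧-sound {problem} (ax-∧ⁱ {A = α}) =
      prove (ƛ□ [] (ƛ□ (problem-stable α ∷ []) (thm ax-∧ⁱ · h₁ · h₀)))
    ⟦⟧-sound {proposition} ax-∨₁ = ax-∨₁
    ⟦⟧-sound {problem}     ax-∨₁ = nec ax-∨₁
    ⟦⟧-sound {proposition} ax-∨₂ = ax-∨₂
    ⟦⟧-sound {problem}     ax-∨₂ = nec ax-∨₂
    ⟦⟧-sound {proposition} ax-∨ᵉ = ax-∨ᵉ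
    ⟦⟧-sound {problem} ax-∨ᵉ =
      prove (ƛ□ [] (ƛ□ (□-stable ∷ []) (ƛ□ (□-stable ∷ □-stable ∷ [])
        (thm ax-∨ᵉ · unbox h₂ · unbox h₁ · h₀))))
    ⟦⟧-sound {proposition} ax-efq = ax-efq
    ⟦⟧-sound {problem}     ax-efq = nec ax-efq
    ⟦⟧-sound {proposition} (ax-∀ᵉ {A = p} ff) = ∀ᵉ-⟦⟧ p ff
    ⟦⟧-sound {problem}     (ax-∀ᵉ {A = α} ff) = prove (ƛ□ [] (thm (∀ᵉ-⟦⟧ α ff) · unbox h₀))
    ⟦⟧-sound {proposition} (ax-∃ⁱ {A = p} ff) = ∃ⁱ-⟦⟧ p ff
    ⟦⟧-sound {problem}     (ax-∃ⁱ {A = α} ff) = nec (∃ⁱ-⟦⟧ α ff)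
    ⟦⟧-sound {proposition} (ax-∀ⁱ {B = q} x∉q) = ax-∀ⁱ (x∉q ∘ Free-⟦⟧ q)
    ⟦⟧-sound {problem} (ax-∀ⁱ {B = β} x∉β) =
      -- The third box belongs to the translated `∀` in the conclusion and stands under `⟦ β ⟧`.
      -- `∀-mono ax-T` strips the box that the premise has beneath its quantifier.
      prove (ƛ□ [] (ƛ□ (□-stable ∷ []) (box (problem-stable β ∷ □-stable ∷ [])
        (thm (ax-∀ⁱ (x∉β ∘ Free-⟦⟧ β)) · (thm (∀-mono ax-T) · unbox h₁) · h₀))))
    ⟦⟧-sound {proposition} (ax-∃ᵉ {B = q} x∉q) = ax-∃ᵉ (x∉q ∘ Free-⟦⟧ q)
    ⟦⟧-sound {problem} (ax-∃ᵉ {B = β} x∉β) =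
      prove (ƛ□ [] (ƛ□ (□-stable ∷ [])
        (thm (ax-∃ᵉ (x∉β ∘ Free-⟦⟧ β)) · (thm (∀-mono ax-T) · unbox h₁) · h₀)))
    ⟦⟧-sound ax-lem = ax-lem
    ⟦⟧-sound (!-rule d) = nec (⟦⟧-sound d)
    ⟦⟧-sound (¿-rule d) = ⟦⟧-sound d
    ⟦⟧-sound ax-¿! = ax-T
    -- Up to the outer box, this axiom translates to stability itself.
    ⟦⟧-sound (ax-!¿ {α = α}) = nec (problem-stable α)
    ⟦⟧-sound ax-!⊃ = prove (ƛ□ [] (ƛ□ (□-stable ∷ []) (thm ax-□ · h₁ · h₀)))
    ⟦⟧-sound ax-¿⊃ = ax-T
    ⟦⟧-sound ax-!𝟘 = nec ax-T
    -- Since `¿` is erased, both sides of the equivalence have the same translation.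
    ⟦⟧-sound ax-¿∧ = mp (mp ax-∧ⁱ ⊃-refl) ⊃-refl
    ⟦⟧-sound ax-¿∨ = mp (mp ax-∧ⁱ ⊃-refl) ⊃-refl
    ⟦⟧-sound ax-¿𝟘 = ⊃-refl
    ⟦⟧-sound ax-¿∃ = mp (mp ax-∧ⁱ ⊃-refl) ⊃-refl
    ⟦⟧-sound ax-¿∀ = ax-T

theorem3p1 : {P Π V : Symbols} (E : Assignment P Π V) → let open Translation E in
    (Γ : List (∃ (QHC.Formula P Π))) {s : QHC.Sort} (A : QHC.Formula P Π s) →
    Γ QHC.⊢ A → ⟦ Γ ⟧* QS4.⊢ ⟦ A ⟧
theorem3p1 E Γ A d = ⟦⟧-sound E Γ d
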